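{- There exist a constant $c>0$ and, for infinitely many positive integers $d$, a high-multiplicity \textsc{Bin Packing} instance with $d$ item types such that every optimal solution vector $x$ of its configuration ILP satisfies $|\mathrm{supp}(x)|\ge 2^{c d}$, i.e. $|\mathrm{supp}(x)|\in 2^{\Omega(d)}$.
   Context: A high-multiplicity \textsc{Bin Packing} instance of dimension $d$ consists of a bin capacity $C$, item sizes $s_1,\dots,s_d\in(0,C]$ and multiplicities $a_1,\dots,a_d\in\mathbb{Z}_{\ge 0}$; the task is to pack all items (for each $i$, $a_i$ items of size $s_i$) into the minimum number of bins of capacity $C$. A configuration is a vector $p\in\mathbb{Z}^d_{\ge 0}$ with $s^Tp\le C$ (a feasible filling of one bin). Letting $\mathcal{C}$ be the set of all configurations, the configuration ILP is $\min\{\mathbf{1}^T x : \sum_{p\in\mathcal{C}} x_p\, p = a,\ x\in\mathbb{Z}^{\mathcal{C}}_{\ge 0}\}$, where $x_p$ is the number of bins filled with configuration $p$. The support of a vector $x$ is $\mathrm{supp}(x)=\{p : x_p\neq 0\}$ (the number of differently filled bins is $|\mathrm{supp}(x)|$). -}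

module Defs where

open import Data.Nat using (ℕ; zero; suc; _+_; _*_; _≤_; _<_; _≤?_; _≟_)
open import Data.List using (List; []; _∷_; [_]; map; concatMap; upTo; filter; length; foldr)
open import Data.Vec using (Vec; []; _∷_; zipWith; replicate; lookup)
import Data.Vec as V
open import Data.Fin using (Fin)
open import Relation.Nullary using (¬_)
open import Relation.Nullary.Decidable using (¬?)
open import Relation.Binary.PropositionalEquality using (_≡_)
open import Data.Product using (_×_)

record Instance (d : ℕ) : Set where
  field
    C    : ℕ
    size : Vec ℕ d
    mult : Vec ℕ d
    size-pos : ∀ (i : Fin d) → 1 ≤ lookup size i
    size-le  : ∀ (i : Fin d) → lookup size i ≤ C
open Instance public

dot : ∀ {d} → Vec ℕ d → Vec ℕ d → ℕ
dot s p = V.sum (zipWith _*_ s p)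

box : ℕ → (d : ℕ) → List (Vec ℕ d)
box B zero    = [ [] ]
box B (suc d) = concatMap (λ v → map (_∷ v) (upTo (suc B))) (box B d)

-- the configurations: p ∈ ℕ^d with s^T p ≤ C.  Since every s_i ≥ 1,
-- every configuration has entries ≤ C, so this list enumerates 𝒞 exactly.
configs : ∀ {d} → Instance d → List (Vec ℕ d)
configs I = filter (λ p → dot (size I) p ≤? C I) (box (C I) _)

-- A vector x ∈ ℤ_{≥0}^𝒞 is represented as a function on ℕ^d that
-- vanishes outside 𝒞.
IsConfig : ∀ {d} → Instance d → Vec ℕ d → Set
IsConfig I p = dot (size I) p ≤ C I

packed : ∀ {d} → (I : Instance d) → (Vec ℕ d → ℕ) → Vec ℕ d
packed {d} I x = foldr (λ p acc → zipWith _+_ (V.map (x p *_) p) acc) (replicate d 0) (configs I)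

objective : ∀ {d} → Instance d → (Vec ℕ d → ℕ) → ℕ
objective I x = foldr (λ p acc → x p + acc) 0 (configs I)

Feasible : ∀ {d} → Instance d → (Vec ℕ d → ℕ) → Set
Feasible I x = (∀ p → ¬ IsConfig I p → x p ≡ 0) × (packed I x ≡ mult I)

Optimal : ∀ {d} → Instance d → (Vec ℕ d → ℕ) → Set
Optimal I x = Feasible I x × (∀ y → Feasible I y → objective I x ≤ objective I y)

suppSize : ∀ {d} → Instance d → (Vec ℕ d → ℕ) → ℕ
suppSize I x = length (filter (λ p → ¬? (x p ≟ 0)) (configs I))

{-# OPTIONS --safe #-}

-- A family of 2^n configurations is built so that one linear form Y takes on
-- it values that behave like digit weights B_j of a number system: Σ x_j B_j
-- = Σ B_j with bounded x_j forces x = 1.  Doubling the family takes five new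
-- item types: a switch b, and two copies of the value Y (and of its complement
-- Z = M − Y), of which the switch makes one vanish and the other equal to the
-- old value.  Weighting the second copy by a large k yields the new form, so
-- the weights grow doubly exponentially while d grows linearly.
--
-- All defining equations are merged into one equation s·p = C, so that the
-- family consists of exactly the configurations without slack.  If a is the
-- sum of the family, an optimal solution has no slack anywhere, hence lives on
-- the family, and Σ x_p Y(p) is determined by a; therefore x = 1 on the family.
module Submission where

open import Defs
open import Data.Nat using (ℕ; _≤_; _<_; _^_; _*_)
open import Data.Product using (Σ; _×_)
open import Data.Fin using (zero; suc)
open import Data.List using (List; []; _∷_; [_]; map; _++_; length; filter; foldr; upTo)
open import Data.List.Membership.Propositional using (_∈_)
open import Data.List.Membership.Propositional.Properties
  using (∈-map⁺; ∈-map⁻; ∈-++⁺ˡ; ∈-++⁺ʳ; ∈-++⁻; ∈-concatMap⁺; ∈-upTo⁺; ∈-filter⁺; ∈-filter⁻)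
open import Data.List.Membership.Propositional.Properties.WithK using (unique∧set⇒bag)
open import Data.List.Properties using (length-++; length-map)
open import Data.List.Relation.Binary.BagAndSetEquality using (∼bag⇒↭)
open import Data.List.Relation.Binary.Permutation.Propositional as Perm using (_↭_)
open import Data.List.Relation.Binary.Permutation.Propositional.Properties using (↭-length)
import Data.List.Relation.Unary.All as All
import Data.List.Relation.Unary.All.Properties as Allₚ
open import Data.List.Relation.Unary.AllPairs as AllPairs using ([]; _∷_)
import Data.List.Relation.Unary.AllPairs.Properties as AllPairsₚ
import Data.List.Relation.Unary.Any as Any
open import Data.List.Relation.Unary.Any using (here; there)
open import Data.List.Relation.Unary.Unique.Propositional using (Unique)
import Data.List.Relation.Unary.Unique.Propositional.Properties as Uniqueₚ
open import Data.Nat using (zero; suc; _+_; _≟_; s≤s; z≤n; >-nonZero)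
open import Data.Nat.DivMod using (_%_; [m+kn]%n≡m%n; m<n⇒m%n≡m)
open import Data.Nat.Properties
open import Data.Nat.Tactic.RingSolver using (solve-∀)
open import Data.Product using (_,_; proj₁; proj₂)
open import Data.Sum using (_⊎_; inj₁; inj₂; [_,_]′)
open import Data.Vec using (Vec; []; _∷_; zipWith; replicate; lookup)
import Data.Vec as V
open import Data.Vec.Properties using (lookup-zipWith; lookup-map; lookup-replicate)
open import Function using (_∘_; mk⇔)
open import Relation.Nullary using (¬_; yes; no; contradiction)
open import Relation.Nullary.Decidable using (¬?)
open import Relation.Binary.PropositionalEquality
  using (_≡_; refl; sym; trans; cong; cong₂; subst; module ≡-Reasoning)
open import Level using (0ℓ)
open import Relation.Unary using (Pred; Decidable)

-- Natural numbers

-- Reduction modulo `k` recovers the remainder, and cancelling it the quotient. This undoes both the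
-- merging of equations and the weighting by `k` in a doubled gadget.
quotRem-unique : ∀ {k a a′ b b′} → a < k → a′ < k → a + k * b ≡ a′ + k * b′ → a ≡ a′ × b ≡ b′
quotRem-unique {k@(suc _)} {a} {a′} {b} {b′} a<k a′<k eq = a≡a′ , b≡b′
  where
  rem : ∀ {r} q → r < k → (r + k * q) % k ≡ r
  rem {r} q r<k = trans (cong (λ z → (r + z) % k) (*-comm k q))
                        (trans ([m+kn]%n≡m%n r q k) (m<n⇒m%n≡m r<k))
  a≡a′ : a ≡ a′
  a≡a′ = trans (sym (rem b a<k)) (trans (cong (_% k) eq) (rem b′ a′<k))
  b≡b′ : b ≡ b′
  b≡b′ = *-cancelˡ-≡ b b′ k (+-cancelˡ-≡ a _ _ (trans eq (cong (_+ k * b′) (sym a≡a′))))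

-- Written as T (u + v) + v = T (b + c) + c with T > b + c, the equation first
-- bounds u + v by b + c, hence v by T, and then (v , u + v) is read off
-- as remainder and quotient modulo T.
split-merged : ∀ b c {u v} → let T = suc (b + c) in
  T * u + suc T * v ≡ T * b + suc T * c → u ≡ b × v ≡ c
split-merged b c {u} {v} eq = +-cancelʳ-≡ v u b (trans u+v≡b+c (cong (b +_) (sym v≡c))) , v≡c
  where
  T : ℕ
  T = suc (b + c)
  regroup : ∀ t x y → t * x + suc t * y ≡ y + t * (x + y)
  regroup = solve-∀
  eq′ : v + T * (u + v) ≡ c + T * (b + c)
  eq′ = trans (sym (regroup T u v)) (trans eq (regroup T b c))
  c<T : c < T
  c<T = s≤s (m≤n+m c b)
  u+v≤b+c : u + v ≤ b + c
  u+v≤b+c = ≤-pred (*-cancelˡ-< T (u + v) T (begin-strict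
    T * (u + v)      ≤⟨ m≤n+m _ v ⟩
    v + T * (u + v)  ≡⟨ eq′ ⟩
    c + T * (b + c)  <⟨ +-monoˡ-< _ c<T ⟩
    T + T * (b + c)  ≡⟨ *-suc T (b + c) ⟨
    T * T            ∎))
    where open ≤-Reasoning
  both : v ≡ c × u + v ≡ b + c
  both = quotRem-unique (s≤s (≤-trans (m≤n+m v u) u+v≤b+c)) c<T eq′
  v≡c : v ≡ c
  v≡c = proj₁ both
  u+v≡b+c : u + v ≡ b + c
  u+v≡b+c = proj₂ both

-- Sums over lists

private variable
  A B : Set

-- The fold has the shape of `objective`, so `objective I x` is `∑ (configs I) x` by definition.
∑ : List A → (A → ℕ) → ℕ
∑ xs f = foldr (λ p acc → f p + acc) 0 xs

∑-cong : ∀ (xs : List A) {f g} → (∀ {p} → p ∈ xs → f p ≡ g p) → ∑ xs f ≡ ∑ xs g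
∑-cong []       eq = refl
∑-cong (x ∷ xs) eq = cong₂ _+_ (eq (here refl)) (∑-cong xs (eq ∘ there))

∑-mono : ∀ (xs : List A) {f g} → (∀ {p} → p ∈ xs → f p ≤ g p) → ∑ xs f ≤ ∑ xs g
∑-mono []       le = z≤n
∑-mono (x ∷ xs) le = +-mono-≤ (le (here refl)) (∑-mono xs (le ∘ there))

-- Bounding the tail of `f` by that of `g` and cancelling gives the reverse inequality at the head;
-- bounding and cancelling the head instead hands `ge` on to the tail.
∑-mono-tight : ∀ (xs : List A) {f g} → (∀ {p} → p ∈ xs → f p ≤ g p) → ∑ xs g ≤ ∑ xs f →
  ∀ {p} → p ∈ xs → f p ≡ g p
∑-mono-tight (x ∷ xs) {f} {g} le ge (here refl) = ≤-antisym (le (here refl))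
  (+-cancelʳ-≤ (∑ xs g) (g x) (f x) (≤-trans ge (+-monoʳ-≤ (f x) (∑-mono xs (le ∘ there)))))
∑-mono-tight (x ∷ xs) {f} {g} le ge (there p∈xs) = ∑-mono-tight xs (le ∘ there)
  (+-cancelˡ-≤ (g x) _ _ (≤-trans ge (+-monoˡ-≤ (∑ xs f) (le (here refl))))) p∈xs

∑-++ : ∀ (xs ys : List A) f → ∑ (xs ++ ys) f ≡ ∑ xs f + ∑ ys f
∑-++ []       ys f = refl
∑-++ (x ∷ xs) ys f = trans (cong (f x +_) (∑-++ xs ys f)) (sym (+-assoc (f x) _ _))

∑-map : ∀ (h : A → B) xs f → ∑ (map h xs) f ≡ ∑ xs (f ∘ h)
∑-map h []       f = refl
∑-map h (x ∷ xs) f = cong (f (h x) +_) (∑-map h xs f)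

∑-*ˡ : ∀ k (xs : List A) f → ∑ xs (λ p → k * f p) ≡ k * ∑ xs f
∑-*ˡ k []       f = sym (*-zeroʳ k)
∑-*ˡ k (x ∷ xs) f = trans (cong (k * f x +_) (∑-*ˡ k xs f)) (sym (*-distribˡ-+ k (f x) _))

∑-const-1 : ∀ (xs : List A) → ∑ xs (λ _ → 1) ≡ length xs
∑-const-1 []       = refl
∑-const-1 (x ∷ xs) = cong suc (∑-const-1 xs)

∈⇒≤∑ : ∀ {xs : List A} {p} f → p ∈ xs → f p ≤ ∑ xs f
∈⇒≤∑ f (here refl)           = m≤m+n _ _
∈⇒≤∑ {xs = x ∷ _} f (there i) = ≤-trans (∈⇒≤∑ f i) (m≤n+m _ (f x))

∑-↭ : ∀ {xs ys : List A} f → xs ↭ ys → ∑ xs f ≡ ∑ ys f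
∑-↭ f Perm.refl         = refl
∑-↭ f (Perm.prep x r)   = cong (f x +_) (∑-↭ f r)
∑-↭ f (Perm.swap x y r) = trans (cong (λ z → f x + (f y + z)) (∑-↭ f r)) (exchange (f x) (f y) _)
  where
  exchange : ∀ a b c → a + (b + c) ≡ b + (a + c)
  exchange = solve-∀
∑-↭ f (Perm.trans r s)  = trans (∑-↭ f r) (∑-↭ f s)

module _ {P : Pred A 0ℓ} (P? : Decidable P) where

  ∑-filter : ∀ xs {f} → (∀ {p} → p ∈ xs → ¬ P p → f p ≡ 0) → ∑ (filter P? xs) f ≡ ∑ xs f
  ∑-filter []       f≡0 = refl
  ∑-filter (x ∷ xs) {f} f≡0 with P? x
  ... | yes _  = cong (f x +_) (∑-filter xs (f≡0 ∘ there))
  ... | no ¬Px = trans (∑-filter xs (f≡0 ∘ there))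
                       (cong (_+ ∑ xs f) (sym (f≡0 (here refl) ¬Px)))

length-filter-mono : ∀ {P Q : Pred A 0ℓ} (P? : Decidable P) (Q? : Decidable Q) xs →
  (∀ {p} → p ∈ xs → P p → Q p) → length (filter P? xs) ≤ length (filter Q? xs)
length-filter-mono P? Q? []       P⇒Q = z≤n
length-filter-mono P? Q? (x ∷ xs) P⇒Q with P? x | Q? x
... | yes _  | yes _  = s≤s (length-filter-mono P? Q? xs (P⇒Q ∘ there))
... | yes Px | no ¬Qx = contradiction (P⇒Q (here refl) Px) ¬Qx
... | no _   | yes _  = m≤n⇒m≤1+n (length-filter-mono P? Q? xs (P⇒Q ∘ there))
... | no _   | no _   = length-filter-mono P? Q? xs (P⇒Q ∘ there)

-- Linear forms

0ᵥ : ∀ {d} → Vec ℕ d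
0ᵥ = replicate _ 0

dot-comm : ∀ {d} (u v : Vec ℕ d) → dot u v ≡ dot v u
dot-comm []      []      = refl
dot-comm (a ∷ u) (b ∷ v) = cong₂ _+_ (*-comm a b) (dot-comm u v)

dot-0ˡ : ∀ {d} (u : Vec ℕ d) → dot 0ᵥ u ≡ 0
dot-0ˡ []      = refl
dot-0ˡ (_ ∷ u) = dot-0ˡ u

dot-+ˡ : ∀ {d} (u v w : Vec ℕ d) → dot (zipWith _+_ u v) w ≡ dot u w + dot v w
dot-+ˡ []      []      []      = refl
dot-+ˡ (a ∷ u) (b ∷ v) (c ∷ w) =
  trans (cong ((a + b) * c +_) (dot-+ˡ u v w)) (regroup a b c (dot u w) (dot v w))
  where
  regroup : ∀ a b c x y → (a + b) * c + (x + y) ≡ (a * c + x) + (b * c + y)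
  regroup = solve-∀

dot-*ˡ : ∀ {d} k (u w : Vec ℕ d) → dot (V.map (k *_) u) w ≡ k * dot u w
dot-*ˡ k []      []      = sym (*-zeroʳ k)
dot-*ˡ k (a ∷ u) (c ∷ w) = trans (cong (k * a * c +_) (dot-*ˡ k u w)) (regroup k a c (dot u w))
  where
  regroup : ∀ k a c x → k * a * c + k * x ≡ k * (a * c + x)
  regroup = solve-∀

dot-lookup : ∀ {d} (u v : Vec ℕ d) i → lookup u i * lookup v i ≤ dot u v
dot-lookup (a ∷ u) (b ∷ v) zero    = m≤m+n _ _
dot-lookup (a ∷ u) (b ∷ v) (suc i) = ≤-trans (dot-lookup u v i) (m≤n+m _ (a * b))

-- Exchange of summation. A packing constraint thus fixes the total of every linear form `u` over
-- the bins.
dot-packed : ∀ {d} (I : Instance d) (x : Vec ℕ d → ℕ) u →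
  dot u (packed I x) ≡ ∑ (configs I) (λ p → x p * dot u p)
dot-packed I x u = go (configs I)
  where
  go : ∀ ps → dot u (foldr (λ p acc → zipWith _+_ (V.map (x p *_) p) acc) 0ᵥ ps)
            ≡ ∑ ps (λ p → x p * dot u p)
  go []       = trans (dot-comm u 0ᵥ) (dot-0ˡ u)
  go (p ∷ ps) = trans (dot-comm u _) (trans (dot-+ˡ (V.map (x p *_) p) _ u)
    (cong₂ _+_ (trans (dot-*ˡ (x p) p u) (cong (x p *_) (dot-comm p u)))
               (trans (dot-comm _ u) (go ps))))

-- Enumeration of the configurations

box-unique : ∀ n d → Unique (box n d)
box-unique n zero    = All.[] ∷ []
box-unique n (suc d) = Uniqueₚ.concat⁺
  (Allₚ.map⁺ (All.universal (λ _ → Uniqueₚ.map⁺ (λ { refl → refl }) (Uniqueₚ.upTo⁺ (suc n))) (box n d)))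
  (AllPairsₚ.map⁺ (AllPairs.map disjoint (box-unique n d)))
  where
  disjoint : ∀ {u v : Vec ℕ d} → ¬ u ≡ v →
    ∀ {w} → ¬ (w ∈ map (_∷ u) (upTo (suc n)) × w ∈ map (_∷ v) (upTo (suc n)))
  disjoint u≢v (i , j) with ∈-map⁻ _ i | ∈-map⁻ _ j
  ... | _ , _ , refl | _ , _ , refl = u≢v refl

∈-box : ∀ {n d} (v : Vec ℕ d) → (∀ i → lookup v i ≤ n) → v ∈ box n d
∈-box             []      v≤n = here refl
∈-box {n} {suc d} (a ∷ v) v≤n = ∈-concatMap⁺ (λ w → map (_∷ w) (upTo (suc n)))
  (Any.map (λ { refl → ∈-map⁺ (_∷ v) (∈-upTo⁺ (s≤s (v≤n zero))) })
           (∈-box v (v≤n ∘ suc)))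

-- Positive sizes give `p_i ≤ s_i p_i ≤ s·p ≤ C`, so `p` lies in the box that is filtered.
∈-configs : ∀ {d} (I : Instance d) {p} → IsConfig I p → p ∈ configs I
∈-configs I {p} p-config = ∈-filter⁺ _ (∈-box p p≤C) p-config
  where
  p≤C : ∀ i → lookup p i ≤ C I
  p≤C i = ≤-trans (m≤n*m (lookup p i) (lookup (size I) i) {{>-nonZero (size-pos I i)}})
                  (≤-trans (dot-lookup (size I) p i) p-config)

configs-unique : ∀ {d} (I : Instance d) → Unique (configs I)
configs-unique I = Uniqueₚ.filter⁺ _ (box-unique (C I) _)

unique∧set⇒↭ : ∀ {xs ys : List A} → Unique xs → Unique ys →
  (∀ {x} → x ∈ xs → x ∈ ys) → (∀ {x} → x ∈ ys → x ∈ xs) → xs ↭ ys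
unique∧set⇒↭ xs! ys! to from = ∼bag⇒↭ (unique∧set⇒bag xs! ys! (mk⇔ to from))

-- Linear equations

record Equation (d : ℕ) : Set where
  constructor _≐_
  field
    coeffs : Vec ℕ d
    rhs    : ℕ
open Equation

infix 4 _⊨_
_⊨_ : ∀ {d} → Vec ℕ d → Equation d → Set
p ⊨ e = dot (coeffs e) p ≡ rhs e

Bounded : ∀ {d} → ℕ → Vec ℕ d → Set
Bounded n u = ∀ i → lookup u i ≤ n

-- With coefficients read as sizes and the right-hand side as capacity, this is the condition
-- `size-le`.
Valid : ∀ {d} → Equation d → Set
Valid e = Bounded (rhs e) (coeffs e)

-- Aggregation of two equations into one with the same solutions over `ℕ`. The multipliers are
-- consecutive and exceed `b + c`, which lets `split-merged` separate them again.
merge : ∀ {d} → Equation d → Equation d → Equation d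
merge (u ≐ b) (v ≐ c) = let T = suc (b + c) in
  zipWith _+_ (V.map (T *_) u) (V.map (suc T *_) v) ≐ (T * b + suc T * c)

module _ {d} (e f : Equation d) where

  private
    T : ℕ
    T = suc (rhs e + rhs f)

    dot-merge : ∀ p → dot (coeffs (merge e f)) p ≡ T * dot (coeffs e) p + suc T * dot (coeffs f) p
    dot-merge p = trans (dot-+ˡ (V.map (T *_) (coeffs e)) _ p)
                        (cong₂ _+_ (dot-*ˡ T (coeffs e) p) (dot-*ˡ (suc T) (coeffs f) p))

    lookup-merge : ∀ i → lookup (coeffs (merge e f)) i
                       ≡ T * lookup (coeffs e) i + suc T * lookup (coeffs f) i
    lookup-merge i = trans (lookup-zipWith _+_ i (V.map (T *_) (coeffs e)) _)
      (cong₂ _+_ (lookup-map i (T *_) (coeffs e)) (lookup-map i (suc T *_) (coeffs f)))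

  ⊨-merge⁺ : ∀ {p} → p ⊨ e → p ⊨ f → p ⊨ merge e f
  ⊨-merge⁺ {p} p⊨e p⊨f = trans (dot-merge p) (cong₂ (λ x y → T * x + suc T * y) p⊨e p⊨f)

  ⊨-merge⁻ : ∀ {p} → p ⊨ merge e f → p ⊨ e × p ⊨ f
  ⊨-merge⁻ {p} p⊨ = split-merged (rhs e) (rhs f) (trans (sym (dot-merge p)) p⊨)

  merge-valid : Valid e → Valid f → Valid (merge e f)
  merge-valid e≤ f≤ i = ≤-trans (≤-reflexive (lookup-merge i))
    (+-mono-≤ (*-monoʳ-≤ T (e≤ i)) (*-monoʳ-≤ (suc T) (f≤ i)))

  merge-pos : ∀ i → 1 ≤ lookup (coeffs e) i ⊎ 1 ≤ lookup (coeffs f) i →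
    1 ≤ lookup (coeffs (merge e f)) i
  merge-pos i pos = ≤-trans
    ([ (λ e≥1 → ≤-trans e≥1 (≤-trans (m≤n*m _ T) (m≤m+n _ _)))
     , (λ f≥1 → ≤-trans f≥1 (≤-trans (m≤n*m _ (suc T)) (m≤n+m _ (T * lookup (coeffs e) i)))) ]′ pos)
    (≤-reflexive (sym (lookup-merge i)))

-- Gadgets

-- Z represents M − Y on sols, with nonnegative coefficients.
record Gadget (d : ℕ) : Set where
  field
    eq   : Equation d
    Y Z  : Vec ℕ d
    M    : ℕ
    sols : List (Vec ℕ d)

-- `L` bounds the multiplicities for which the values of `Y` act as digit weights in `rigid`. `Y≤M`
-- and `Z≤M` keep the next doubling valid, where `Y` and `Z` become coefficients with right-hand
-- side `M`.
record Correct (L : ℕ) {d} (G : Gadget d) : Set where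
  open Gadget G
  field
    M-pos    : 1 ≤ M
    eq-valid : Valid eq
    eq-pos   : ∀ i → 1 ≤ lookup (coeffs eq) i
    Y≤M      : Bounded M Y
    Z≤M      : Bounded M Z
    sound    : ∀ {p} → p ∈ sols → p ⊨ eq
    complete : ∀ {p} → p ⊨ eq → p ∈ sols
    balance  : ∀ {p} → p ∈ sols → dot Y p + dot Z p ≡ M
    unique   : Unique sols
    rigid    : ∀ (x : Vec ℕ d → ℕ) → (∀ {p} → p ∈ sols → x p ≤ L) →
      ∑ sols (λ p → x p * dot Y p) ≡ ∑ sols (dot Y) → ∀ {p} → p ∈ sols → x p ≡ 1

unit : Gadget 1
unit = record
  { eq = (1 ∷ []) ≐ 1 ; Y = 1 ∷ [] ; Z = 0 ∷ [] ; M = 1 ; sols = [ 1 ∷ [] ] }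

unit-correct : ∀ {L} → Correct L unit
unit-correct = record
  { M-pos    = ≤-refl
  ; eq-valid = λ { zero → ≤-refl }
  ; eq-pos   = λ { zero → ≤-refl }
  ; Y≤M      = λ { zero → ≤-refl }
  ; Z≤M      = λ { zero → z≤n }
  ; sound    = λ { (here refl) → refl }
  ; complete = complete
  ; balance  = λ { (here refl) → refl }
  ; unique   = All.[] ∷ []
  ; rigid    = λ { x _ eq (here refl) → trans (sym (trans (+-identityʳ _) (*-identityʳ _))) eq }
  }
  where
  complete : ∀ {p : Vec ℕ 1} → p ⊨ Gadget.eq unit → p ∈ Gadget.sols unit
  complete {a ∷ []} eq with refl ← trans (sym (trans (+-identityʳ _) (*-identityˡ a))) eq = here refl

-- The switch b selects the copy that carries (y , z).
branch : ∀ {M y z y₀ y₁ z₀ z₁} b → 1 ≤ M → y + z ≡ M →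
  y₀ + y₁ + z ≡ M → z₀ + z₁ + y ≡ M → y₁ + z₁ + M * b ≡ M →
  (b ≡ 1 × (y₀ ≡ y × y₁ ≡ 0) × (z₀ ≡ z × z₁ ≡ 0)) ⊎
  (b ≡ 0 × (y₀ ≡ 0 × y₁ ≡ y) × (z₀ ≡ 0 × z₁ ≡ z))
branch {M} {y} {z} {y₀} {y₁} {z₀} {z₁} zero 1≤M y+z h₁ h₂ h₃ = inj₂
  ( refl
  , (y₀≡0 , +-cancelʳ-≡ z y₁ y (trans (subst (λ a → a + y₁ + z ≡ M) y₀≡0 h₁) (sym y+z)))
  , (z₀≡0 , +-cancelʳ-≡ y z₁ z (trans (subst (λ a → a + z₁ + y ≡ M) z₀≡0 h₂)
                                      (trans (sym y+z) (+-comm y z)))))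
  where
  y₁+z₁≡M : y₁ + z₁ ≡ M
  y₁+z₁≡M = trans (sym (trans (cong (y₁ + z₁ +_) (*-zeroʳ M)) (+-identityʳ _))) h₃
  regroup : ∀ y z y₀ y₁ z₀ z₁ →
    (y₀ + z₀) + ((y₁ + z₁) + (y + z)) ≡ (y₀ + y₁ + z) + (z₀ + z₁ + y)
  regroup = solve-∀
  -- The first two equations add up to `M + M`, which `y₁ + z₁` and `y + z` already use up.
  y₀+z₀≡0 : y₀ + z₀ ≡ 0
  y₀+z₀≡0 = +-cancelʳ-≡ (M + M) (y₀ + z₀) 0 (begin
    y₀ + z₀ + (M + M)                     ≡⟨ cong₂ (λ a b → y₀ + z₀ + (a + b)) y₁+z₁≡M y+z ⟨
    y₀ + z₀ + ((y₁ + z₁) + (y + z))       ≡⟨ regroup y z y₀ y₁ z₀ z₁ ⟩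
    (y₀ + y₁ + z) + (z₀ + z₁ + y)         ≡⟨ cong₂ _+_ h₁ h₂ ⟩
    M + M                                 ∎)
    where open ≡-Reasoning
  y₀≡0 : y₀ ≡ 0
  y₀≡0 = m+n≡0⇒m≡0 y₀ y₀+z₀≡0
  z₀≡0 : z₀ ≡ 0
  z₀≡0 = m+n≡0⇒n≡0 y₀ y₀+z₀≡0
branch {M} {y} {z} {y₀} {y₁} {z₀} {z₁} (suc zero) 1≤M y+z h₁ h₂ h₃ = inj₁
  ( refl
  , (+-cancelʳ-≡ z y₀ y (trans (cong (_+ z) (sym (+-identityʳ y₀)))
      (trans (subst (λ a → y₀ + a + z ≡ M) y₁≡0 h₁) (sym y+z))) , y₁≡0)
  , (+-cancelʳ-≡ y z₀ z (trans (cong (_+ y) (sym (+-identityʳ z₀)))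
      (trans (subst (λ a → z₀ + a + y ≡ M) z₁≡0 h₂) (trans (sym y+z) (+-comm y z)))) , z₁≡0))
  where
  y₁+z₁≡0 : y₁ + z₁ ≡ 0
  y₁+z₁≡0 = +-cancelʳ-≡ M (y₁ + z₁) 0 (trans (cong (y₁ + z₁ +_) (sym (*-identityʳ M))) h₃)
  y₁≡0 : y₁ ≡ 0
  y₁≡0 = m+n≡0⇒m≡0 y₁ y₁+z₁≡0
  z₁≡0 : z₁ ≡ 0
  z₁≡0 = m+n≡0⇒n≡0 y₁ y₁+z₁≡0
-- A switch of at least 2 contributes at least `M + M`, more than `M` since `M` is positive.
branch {M} {y₁ = y₁} {z₁ = z₁} (suc (suc b)) 1≤M _ _ _ h₃ = contradiction h₃ (>⇒≢ (begin-strict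
  M                              <⟨ m<m+n M 1≤M ⟩
  M + M                          ≤⟨ m≤m+n (M + M) (M * b) ⟩
  M + M + M * b                  ≡⟨ +-assoc M M _ ⟩
  M + (M + M * b)                ≡⟨ cong (M +_) (*-suc M b) ⟨
  M + M * suc b                  ≡⟨ *-suc M (suc b) ⟨
  M * suc (suc b)                ≤⟨ m≤n+m _ (y₁ + z₁) ⟩
  y₁ + z₁ + M * suc (suc b)      ∎))
  where open ≤-Reasoning

-- Doubling a gadget

module Double (L : ℕ) {d : ℕ} (G : Gadget d) where
  open Gadget G

  -- With multiplicities at most `L` the family reaches a `Y`-total of at most `L * W`, so any such
  -- total is a single digit in base `k`.
  W k : ℕ
  W = ∑ sols (dot Y)
  k = suc (L * W)

  -- The new entries are `y₀`, `y₁`, `z₀`, `z₁` and the switch `b`, which is 1 in `ext₀` and 0 in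
  -- `ext₁`.
  ext₀ ext₁ : Vec ℕ d → Vec ℕ (5 + d)
  ext₀ p = dot Y p ∷ 0 ∷ dot Z p ∷ 0 ∷ 1 ∷ p
  ext₁ p = 0 ∷ dot Y p ∷ 0 ∷ dot Z p ∷ 0 ∷ p

  -- As `Z` stands for `M − Y` on solutions, `splitY` says `y₀ + y₁ = Y·p` without a negative
  -- coefficient, and `splitZ` says `z₀ + z₁ = Z·p`. In `switch`, `b = 1` forces `y₁ = z₁ = 0`,
  -- while `b = 0` demands `y₁ + z₁ = M`, leaving nothing for the first copy.
  splitY splitZ switch old links allLinks : Equation (5 + d)
  splitY = (1 ∷ 1 ∷ 0 ∷ 0 ∷ 0 ∷ Z) ≐ M
  splitZ = (0 ∷ 0 ∷ 1 ∷ 1 ∷ 0 ∷ Y) ≐ M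
  switch = (0 ∷ 1 ∷ 0 ∷ 1 ∷ M ∷ 0ᵥ) ≐ M
  old    = (0 ∷ 0 ∷ 0 ∷ 0 ∷ 0 ∷ coeffs eq) ≐ rhs eq
  links    = merge switch old
  allLinks = merge splitZ links

  double : Gadget (5 + d)
  double = record
    { eq   = merge splitY allLinks
    ; Y    = 1 ∷ k ∷ 0 ∷ 0 ∷ 0 ∷ 0ᵥ
    -- The copies contribute `k * M` to the new `Y + Z` on `ext₁` but only `M` on `ext₀`; the switch
    -- coefficient `L * W * M`, which is `(k − 1) * M`, makes up the difference.
    ; Z    = 0 ∷ 0 ∷ 1 ∷ k ∷ L * W * M ∷ 0ᵥ
    ; M    = k * M
    ; sols = map ext₀ sols ++ map ext₁ sols
    }

  module _ (1≤L : 1 ≤ L) (correct : Correct L G) where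
    open Correct correct
    private module D = Gadget double

    0ᵥ-bounded : ∀ {n} → Bounded n (0ᵥ {d})
    0ᵥ-bounded i = ≤-trans (≤-reflexive (lookup-replicate i 0)) z≤n

    splitY-valid : Valid splitY
    splitY-valid zero                            = M-pos
    splitY-valid (suc zero)                      = M-pos
    splitY-valid (suc (suc zero))                = z≤n
    splitY-valid (suc (suc (suc zero)))          = z≤n
    splitY-valid (suc (suc (suc (suc zero))))    = z≤n
    splitY-valid (suc (suc (suc (suc (suc i))))) = Z≤M i

    splitZ-valid : Valid splitZ
    splitZ-valid zero                            = z≤n
    splitZ-valid (suc zero)                      = z≤n
    splitZ-valid (suc (suc zero))                = M-pos
    splitZ-valid (suc (suc (suc zero)))          = M-pos
    splitZ-valid (suc (suc (suc (suc zero))))    = z≤n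
    splitZ-valid (suc (suc (suc (suc (suc i))))) = Y≤M i

    switch-valid : Valid switch
    switch-valid zero                            = z≤n
    switch-valid (suc zero)                      = M-pos
    switch-valid (suc (suc zero))                = z≤n
    switch-valid (suc (suc (suc zero)))          = M-pos
    switch-valid (suc (suc (suc (suc zero))))    = ≤-refl
    switch-valid (suc (suc (suc (suc (suc i))))) = 0ᵥ-bounded i

    old-valid : Valid old
    old-valid zero                            = z≤n
    old-valid (suc zero)                      = z≤n
    old-valid (suc (suc zero))                = z≤n
    old-valid (suc (suc (suc zero)))          = z≤n
    old-valid (suc (suc (suc (suc zero))))    = z≤n
    old-valid (suc (suc (suc (suc (suc i))))) = eq-valid i

    double-valid : Valid D.eq
    double-valid = merge-valid splitY allLinks splitY-valid
      (merge-valid splitZ links splitZ-valid (merge-valid switch old switch-valid old-valid))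

    -- None of the four equations involves every item type, but together they do, and merging
    -- preserves positivity.
    double-pos : ∀ i → 1 ≤ lookup (coeffs D.eq) i
    double-pos i = merge-pos splitY allLinks i (cover i)
      where
      viaZ : ∀ i → 1 ≤ lookup (coeffs splitZ) i ⊎ 1 ≤ lookup (coeffs links) i →
        1 ≤ lookup (coeffs allLinks) i
      viaZ = merge-pos splitZ links
      cover : ∀ i → 1 ≤ lookup (coeffs splitY) i ⊎
                    1 ≤ lookup (coeffs allLinks) i
      cover zero                                = inj₁ ≤-refl
      cover (suc zero)                          = inj₁ ≤-refl
      cover i@(suc (suc zero))                  = inj₂ (viaZ i (inj₁ ≤-refl))
      cover i@(suc (suc (suc zero)))            = inj₂ (viaZ i (inj₁ ≤-refl))
      cover i@(suc (suc (suc (suc zero))))      =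
        inj₂ (viaZ i (inj₂ (merge-pos switch old i (inj₁ M-pos))))
      cover i@(suc (suc (suc (suc (suc j)))))   =
        inj₂ (viaZ i (inj₂ (merge-pos switch old i (inj₂ (eq-pos j)))))

    1≤kM : 1 ≤ k * M
    1≤kM = ≤-trans M-pos (m≤n*m M k)

    k≤kM : k ≤ k * M
    k≤kM = m≤m*n k M {{>-nonZero M-pos}}

    double-Y≤M : Bounded D.M D.Y
    double-Y≤M zero                            = 1≤kM
    double-Y≤M (suc zero)                      = k≤kM
    double-Y≤M (suc (suc zero))                = z≤n
    double-Y≤M (suc (suc (suc zero)))          = z≤n
    double-Y≤M (suc (suc (suc (suc zero))))    = z≤n
    double-Y≤M (suc (suc (suc (suc (suc i))))) = 0ᵥ-bounded i

    double-Z≤M : Bounded D.M D.Z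
    double-Z≤M zero                            = z≤n
    double-Z≤M (suc zero)                      = z≤n
    double-Z≤M (suc (suc zero))                = 1≤kM
    double-Z≤M (suc (suc (suc zero)))          = k≤kM
    double-Z≤M (suc (suc (suc (suc zero))))    = m≤n+m _ M
    double-Z≤M (suc (suc (suc (suc (suc i))))) = 0ᵥ-bounded i

    sols-elim : ∀ (Q : Vec ℕ (5 + d) → Set) → (∀ {p} → p ∈ sols → Q (ext₀ p)) →
      (∀ {p} → p ∈ sols → Q (ext₁ p)) → ∀ {q} → q ∈ D.sols → Q q
    sols-elim Q Q₀ Q₁ q∈ with ∈-++⁻ (map ext₀ sols) q∈
    ... | inj₁ i with _ , p∈ , refl ← ∈-map⁻ ext₀ i = Q₀ p∈
    ... | inj₂ i with _ , p∈ , refl ← ∈-map⁻ ext₁ i = Q₁ p∈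

    ext₀∈ : ∀ {p} → p ∈ sols → ext₀ p ∈ D.sols
    ext₀∈ = ∈-++⁺ˡ ∘ ∈-map⁺ ext₀

    ext₁∈ : ∀ {p} → p ∈ sols → ext₁ p ∈ D.sols
    ext₁∈ = ∈-++⁺ʳ (map ext₀ sols) ∘ ∈-map⁺ ext₁

    double-sound : ∀ {q} → q ∈ D.sols → q ⊨ D.eq
    double-sound = sols-elim (_⊨ D.eq)
      (λ {p} p∈ → combine (ext₀ p)
        (trans (cong (_+ dot Z p) (+-identityʳ _)) (balance p∈))
        (trans (cong (_+ dot Y p) (+-identityʳ _))
               (trans (+-comm (dot Z p) _) (balance p∈)))
        (trans (cong₂ _+_ (*-identityʳ M) (dot-0ˡ p)) (+-identityʳ M))
        (sound p∈))
      (λ {p} p∈ → combine (ext₁ p)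
        (trans (cong (_+ dot Z p) (+-identityʳ _)) (balance p∈))
        (trans (cong (_+ dot Y p) (+-identityʳ _)) (trans (+-comm (dot Z p) _) (balance p∈)))
        (trans (cong₂ (λ a b → dot Y p + 0 + (dot Z p + 0 + (a + b))) (*-zeroʳ M) (dot-0ˡ p))
          (trans (cong₂ _+_ (+-identityʳ (dot Y p)) (trans (+-identityʳ _) (+-identityʳ _)))
                 (balance p∈)))
        (sound p∈))
      where
      combine : ∀ q → q ⊨ splitY → q ⊨ splitZ → q ⊨ switch → q ⊨ old → q ⊨ D.eq
      combine q h₁ h₂ h₃ h₄ = ⊨-merge⁺ splitY allLinks {q} h₁
        (⊨-merge⁺ splitZ links {q} h₂ (⊨-merge⁺ switch old {q} h₃ h₄))

    -- The last equation puts the old part `p` into `sols`, so its `Y` and `Z` values add up to `M`;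
    -- `branch` then determines the five new entries.
    split-complete : ∀ q → q ⊨ splitY → q ⊨ splitZ → q ⊨ switch → q ⊨ old → q ∈ D.sols
    split-complete (y₀ ∷ y₁ ∷ z₀ ∷ z₁ ∷ b ∷ p) h₁ h₂ h₃ h₄ = conclude
      (branch b M-pos (balance p∈) (trans (pair y₀ y₁ (dot Z p)) h₁) (trans (pair z₀ z₁ (dot Y p)) h₂)
        (trans (trans (cong (y₁ + z₁ +_) (sym (trans (cong (M * b +_) (dot-0ˡ p)) (+-identityʳ _))))
                      (pair y₁ z₁ (M * b + dot 0ᵥ p))) h₃))
      where
      p∈ : p ∈ sols
      p∈ = complete h₄
      pair : ∀ a b c → a + b + c ≡ (a + 0) + ((b + 0) + c)
      pair = solve-∀
      conclude :
        (b ≡ 1 × (y₀ ≡ dot Y p × y₁ ≡ 0) × (z₀ ≡ dot Z p × z₁ ≡ 0)) ⊎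
        (b ≡ 0 × (y₀ ≡ 0 × y₁ ≡ dot Y p) × (z₀ ≡ 0 × z₁ ≡ dot Z p)) →
        (y₀ ∷ y₁ ∷ z₀ ∷ z₁ ∷ b ∷ p) ∈ D.sols
      conclude (inj₁ (refl , (refl , refl) , (refl , refl))) = ext₀∈ p∈
      conclude (inj₂ (refl , (refl , refl) , (refl , refl))) = ext₁∈ p∈

    double-complete : ∀ {q} → q ⊨ D.eq → q ∈ D.sols
    double-complete {q} h = split-complete q (proj₁ h₁) (proj₁ h₂) (proj₁ h₃) (proj₂ h₃)
      where
      h₁ : q ⊨ splitY × q ⊨ allLinks
      h₁ = ⊨-merge⁻ splitY allLinks {q} h
      h₂ : q ⊨ splitZ × q ⊨ links
      h₂ = ⊨-merge⁻ splitZ links {q} (proj₂ h₁)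
      h₃ : q ⊨ switch × q ⊨ old
      h₃ = ⊨-merge⁻ switch old {q} (proj₂ h₂)

    dot-Y₀ : ∀ p → dot D.Y (ext₀ p) ≡ dot Y p
    dot-Y₀ p = trans (cong₂ _+_ (+-identityʳ _) (cong₂ _+_ (*-zeroʳ k) (dot-0ˡ p))) (+-identityʳ _)

    dot-Y₁ : ∀ p → dot D.Y (ext₁ p) ≡ k * dot Y p
    dot-Y₁ p = trans (cong (k * dot Y p +_) (dot-0ˡ p)) (+-identityʳ _)

    dot-Z₀ : ∀ p → dot D.Z (ext₀ p) ≡ dot Z p + L * W * M
    dot-Z₀ p = trans (cong₂ (λ a b → dot Z p + 0 + (a + (L * W * M * 1 + b))) (*-zeroʳ k) (dot-0ˡ p))
                     (simplify (dot Z p) (L * W * M))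
      where
      simplify : ∀ a b → a + 0 + (0 + (b * 1 + 0)) ≡ a + b
      simplify = solve-∀

    dot-Z₁ : ∀ p → dot D.Z (ext₁ p) ≡ k * dot Z p
    dot-Z₁ p = trans (cong (k * dot Z p +_) (cong₂ _+_ (*-zeroʳ (L * W * M)) (dot-0ˡ p))) (+-identityʳ _)

    double-balance : ∀ {q} → q ∈ D.sols → dot D.Y q + dot D.Z q ≡ D.M
    double-balance = sols-elim (λ q → dot D.Y q + dot D.Z q ≡ D.M)
      (λ {p} p∈ → trans (cong₂ _+_ (dot-Y₀ p) (dot-Z₀ p))
        -- As `k` is a successor, `k * M` unfolds to `M + L * W * M`.
        (trans (sym (+-assoc (dot Y p) _ _)) (cong (_+ L * W * M) (balance p∈))))
      (λ {p} p∈ → trans (cong₂ _+_ (dot-Y₁ p) (dot-Z₁ p))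
        (trans (sym (*-distribˡ-+ k (dot Y p) _)) (cong (k *_) (balance p∈))))

    double-unique : Unique D.sols
    double-unique = Uniqueₚ.++⁺
      (Uniqueₚ.map⁺ (cong drop₅) unique)
      (Uniqueₚ.map⁺ (cong drop₅) unique)
      disjoint
      where
      drop₅ : Vec ℕ (5 + d) → Vec ℕ d
      drop₅ = V.drop 5
      -- The switch entries 1 and 0 tell the halves apart.
      disjoint : ∀ {q} → ¬ (q ∈ map ext₀ sols × q ∈ map ext₁ sols)
      disjoint (i , j) with ∈-map⁻ ext₀ i | ∈-map⁻ ext₁ j
      ... | _ , _ , refl | _ , _ , ()

    ∑-split : ∀ f → ∑ D.sols f ≡ ∑ sols (f ∘ ext₀) + ∑ sols (f ∘ ext₁)
    ∑-split f = trans (∑-++ (map ext₀ sols) _ f) (cong₂ _+_ (∑-map ext₀ sols f) (∑-map ext₁ sols f))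

    -- The total takes the form of a two-digit number in base `k`, each half of the family feeding
    -- one digit.
    ∑-Y : ∀ (x : Vec ℕ (5 + d) → ℕ) → ∑ D.sols (λ q → x q * dot D.Y q) ≡
      ∑ sols (λ p → x (ext₀ p) * dot Y p) + k * ∑ sols (λ p → x (ext₁ p) * dot Y p)
    ∑-Y x = trans (∑-split (λ q → x q * dot D.Y q)) (cong₂ _+_
      (∑-cong sols (λ {p} _ → cong (x (ext₀ p) *_) (dot-Y₀ p)))
      (trans (∑-cong sols (λ {p} _ → trans (cong (x (ext₁ p) *_) (dot-Y₁ p))
                                            (swap (x (ext₁ p)) k (dot Y p))))
             (∑-*ˡ k sols _)))
      where
      swap : ∀ a b c → a * (b * c) ≡ b * (a * c)
      swap = solve-∀

    -- Both partial sums are smaller than k, so they are the base-k digits of the total.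
    double-rigid : ∀ (x : Vec ℕ (5 + d) → ℕ) → (∀ {q} → q ∈ D.sols → x q ≤ L) →
      ∑ D.sols (λ q → x q * dot D.Y q) ≡ ∑ D.sols (dot D.Y) → ∀ {q} → q ∈ D.sols → x q ≡ 1
    double-rigid x x≤L total = sols-elim (λ q → x q ≡ 1)
      (rigid (x ∘ ext₀) (x≤L ∘ ext₀∈) (proj₁ digits))
      (rigid (x ∘ ext₁) (x≤L ∘ ext₁∈) (proj₂ digits))
      where
      -- The prescribed total is the same expansion for `x = 1`.
      total₁ : ∑ D.sols (dot D.Y) ≡ W + k * W
      total₁ = trans (∑-cong D.sols (λ {q} _ → sym (*-identityˡ (dot D.Y q))))
        (trans (∑-Y (λ _ → 1)) (cong₂ (λ a b → a + k * b) ones ones))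
        where
        ones : ∑ sols (λ p → 1 * dot Y p) ≡ W
        ones = ∑-cong sols (λ {p} _ → *-identityˡ (dot Y p))
      digits : ∑ sols (λ p → x (ext₀ p) * dot Y p) ≡ W × ∑ sols (λ p → x (ext₁ p) * dot Y p) ≡ W
      digits = quotRem-unique
        (s≤s (≤-trans (∑-mono sols (λ {p} p∈ → *-monoˡ-≤ (dot Y p) (x≤L (ext₀∈ p∈))))
                      (≤-reflexive (∑-*ˡ L sols (dot Y)))))
        -- The target digit `W` is below `k` because `1 ≤ L`.
        (s≤s (m≤n*m W L {{>-nonZero 1≤L}}))
        (trans (sym (∑-Y x)) (trans total total₁))

    double-correct : Correct L double
    double-correct = record
      { M-pos    = 1≤kM
      ; eq-valid = double-valid
      ; eq-pos   = double-pos
      ; Y≤M      = double-Y≤M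
      ; Z≤M      = double-Z≤M
      ; sound    = double-sound
      ; complete = double-complete
      ; balance  = double-balance
      ; unique   = double-unique
      ; rigid    = double-rigid
      }

-- Iterated doubling

dim : ℕ → ℕ
dim zero    = 1
dim (suc n) = 5 + dim n

gadget : ∀ (L n : ℕ) → Gadget (dim n)
gadget L zero    = unit
gadget L (suc n) = Double.double L (gadget L n)

gadget-correct : ∀ {L} n → 1 ≤ L → Correct L (gadget L n)
gadget-correct     zero    1≤L = unit-correct
gadget-correct {L} (suc n) 1≤L = Double.double-correct L (gadget L n) 1≤L (gadget-correct n 1≤L)

-- The weights depend on `L` but the number of solutions does not, so `L` can be set to that number
-- without circularity.
length-sols : ∀ L n → length (Gadget.sols (gadget L n)) ≡ 2 ^ n
length-sols L zero    = refl
length-sols L (suc n) = begin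
  length (map ext₀ sols ++ map ext₁ sols)          ≡⟨ length-++ (map ext₀ sols) ⟩
  length (map ext₀ sols) + length (map ext₁ sols)  ≡⟨ cong₂ _+_ (length-map ext₀ sols) (length-map ext₁ sols) ⟩
  length sols + length sols                        ≡⟨ cong₂ _+_ (length-sols L n) (length-sols L n) ⟩
  2 ^ n + 2 ^ n                                    ≡⟨ cong (2 ^ n +_) (+-identityʳ _) ⟨
  2 ^ suc n                                        ∎
  where
  open ≡-Reasoning
  open Gadget (gadget L n) using (sols)
  open Double L (gadget L n) using (ext₀; ext₁)

-- The bin packing instance of a gadget

module Packing {d} (G : Gadget d) (correct : Correct (length (Gadget.sols G)) G) where
  open Gadget G
  open Correct correct

  private
    s : Vec ℕ d
    s = coeffs eq

    cap : ℕ
    cap = rhs eq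

  -- The reference packing: one bin for each member of the family, recognised by the absence of
  -- slack.
  full : Vec ℕ d → ℕ
  full p with dot s p ≟ cap
  ... | yes _ = 1
  ... | no  _ = 0

  full-yes : ∀ {p} → p ⊨ eq → full p ≡ 1
  full-yes {p} p⊨eq with dot s p ≟ cap
  ... | yes _ = refl
  ... | no  n = contradiction p⊨eq n

  full-no : ∀ {p} → ¬ p ⊨ eq → full p ≡ 0
  full-no {p} p⊭eq with dot s p ≟ cap
  ... | yes y = contradiction y p⊭eq
  ... | no  _ = refl

  -- The multiplicities of `inst` are a value of `packed`, which itself takes an instance.
  -- `emptyInstance`, with the same sizes and capacity, breaks this circle and makes `full` feasible
  -- by `refl`.
  emptyInstance inst : Instance d
  emptyInstance = record
    { C = cap ; size = s ; mult = 0ᵥ ; size-pos = eq-pos ; size-le = eq-valid }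
  inst = record
    { C = cap ; size = s ; mult = packed emptyInstance full ; size-pos = eq-pos ; size-le = eq-valid }

  full-feasible : Feasible inst full
  full-feasible = (λ p ¬config → full-no {p} (λ p⊨eq → ¬config (≤-reflexive p⊨eq))) , refl

  tight? : Decidable (_⊨ eq)
  tight? p = dot s p ≟ cap

  -- One list is enumerated, the other built recursively; both are duplicate-free with the same
  -- members, so sums and lengths carry over.
  tight↭sols : filter tight? (configs inst) ↭ sols
  tight↭sols = unique∧set⇒↭ (Uniqueₚ.filter⁺ tight? (configs-unique inst)) unique
    (λ i → complete (proj₂ (∈-filter⁻ tight? {xs = configs inst} i)))
    (λ i → ∈-filter⁺ tight? (∈-configs inst (≤-reflexive (sound i))) (sound i))

  ∑-configs : ∀ {f} → (∀ {p} → p ∈ configs inst → ¬ p ⊨ eq → f p ≡ 0) →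
    ∑ (configs inst) f ≡ ∑ sols f
  ∑-configs {f} f≡0 = trans (sym (∑-filter tight? (configs inst) f≡0)) (∑-↭ f tight↭sols)

  module _ {x : Vec ℕ d → ℕ} (optimal : Optimal inst x) where

    -- Both `x` and `full` pack the same items. The case `u = s` compares volumes, the case `u = Y`
    -- feeds `rigid`.
    same-totals : ∀ u → ∑ (configs inst) (λ p → x p * dot u p) ≡ ∑ (configs inst) (λ p → full p * dot u p)
    same-totals u = begin
      ∑ (configs inst) (λ p → x p * dot u p)     ≡⟨ dot-packed inst x u ⟨
      dot u (packed inst x)                      ≡⟨ cong (dot u) (proj₂ (proj₁ optimal)) ⟩
      dot u (packed inst full)                   ≡⟨ dot-packed inst full u ⟩
      ∑ (configs inst) (λ p → full p * dot u p)  ∎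
      where open ≡-Reasoning

    fewer-bins : ∑ (configs inst) x ≤ ∑ (configs inst) full
    fewer-bins = proj₂ optimal full full-feasible

    full-volume : ∀ p → full p * dot s p ≡ cap * full p
    full-volume p with dot s p ≟ cap
    ... | yes eq = trans (cong (1 *_) eq) (*-comm 1 cap)
    ... | no  _  = sym (*-zeroʳ cap)

    -- x carries the volume of full with at most as many bins, and all bins of full are filled up.
    no-slack : ∀ {p} → p ∈ configs inst → x p * dot s p ≡ cap * x p
    no-slack = ∑-mono-tight (configs inst)
      (λ {p} i → ≤-trans (*-monoʳ-≤ (x p) (proj₂ (∈-filter⁻ _ {xs = box cap d} i)))
                         (≤-reflexive (*-comm (x p) cap)))
      (begin
        ∑ (configs inst) (λ p → cap * x p)         ≡⟨ ∑-*ˡ cap (configs inst) x ⟩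
        cap * ∑ (configs inst) x                   ≤⟨ *-monoʳ-≤ cap fewer-bins ⟩
        cap * ∑ (configs inst) full                ≡⟨ ∑-*ˡ cap (configs inst) full ⟨
        ∑ (configs inst) (λ p → cap * full p)      ≡⟨ ∑-cong (configs inst) (λ {p} _ → full-volume p) ⟨
        ∑ (configs inst) (λ p → full p * dot s p)  ≡⟨ same-totals s ⟨
        ∑ (configs inst) (λ p → x p * dot s p)     ∎)
      where open ≤-Reasoning

    -- A positive `x p` cancels from `no-slack`, which makes `p` tight.
    supported-on-tight : ∀ {p} → p ∈ configs inst → ¬ p ⊨ eq → x p ≡ 0
    supported-on-tight {p} i p⊭eq with x p | no-slack i
    ... | zero  | _ = refl
    ... | suc m | h = contradiction
      (*-cancelˡ-≡ (dot s p) cap (suc m) (trans h (*-comm cap (suc m)))) p⊭eq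

    -- One multiplicity is at most the number of bins, which by optimality is at most that of
    -- `full`. This is the bound `L` that `rigid` asks for.
    x-bounded : ∀ {p} → p ∈ sols → x p ≤ length sols
    x-bounded {p} i = begin
      x p                      ≤⟨ ∈⇒≤∑ x i ⟩
      ∑ sols x                 ≡⟨ ∑-configs supported-on-tight ⟨
      ∑ (configs inst) x       ≤⟨ fewer-bins ⟩
      ∑ (configs inst) full    ≡⟨ ∑-configs (λ {p} _ → full-no {p}) ⟩
      ∑ sols full              ≡⟨ ∑-cong sols (λ {p} j → full-yes {p} (sound j)) ⟩
      ∑ sols (λ _ → 1)         ≡⟨ ∑-const-1 sols ⟩
      length sols              ∎
      where open ≤-Reasoning

    x≡1 : ∀ {p} → p ∈ sols → x p ≡ 1
    x≡1 = rigid x x-bounded (begin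
      ∑ sols (λ p → x p * dot Y p)
        ≡⟨ ∑-configs (λ {p} i p⊭eq → cong (_* dot Y p) (supported-on-tight i p⊭eq)) ⟨
      ∑ (configs inst) (λ p → x p * dot Y p)
        ≡⟨ same-totals Y ⟩
      ∑ (configs inst) (λ p → full p * dot Y p)
        ≡⟨ ∑-configs (λ {p} _ p⊭eq → cong (_* dot Y p) (full-no {p} p⊭eq)) ⟩
      ∑ sols (λ p → full p * dot Y p)
        ≡⟨ ∑-cong sols (λ {p} i → trans (cong (_* dot Y p) (full-yes {p} (sound i))) (*-identityˡ _)) ⟩
      ∑ sols (dot Y) ∎)
      where open ≡-Reasoning

    large-support : length sols ≤ suppSize inst x
    large-support = begin
      length sols                           ≡⟨ ↭-length tight↭sols ⟨
      length (filter tight? (configs inst)) ≤⟨ length-filter-mono tight? (λ p → ¬? (x p ≟ 0)) (configs inst)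
                                                 (λ _ p⊨eq x≡0 → 0≢1+n (trans (sym x≡0) (x≡1 (complete p⊨eq)))) ⟩
      suppSize inst x                       ∎
      where open ≤-Reasoning

-- The exponential bound

n<dim : ∀ n → n < dim n
n<dim zero    = s≤s z≤n
n<dim (suc n) = s≤s (≤-trans (n<dim n) (m≤n+m _ 4))

-- The dimension is `5n + 1`, which is at most `6n` once `n` is positive.
dim≤ : ∀ n → dim (suc n) ≤ suc n * 6
dim≤ zero    = ≤-refl
dim≤ (suc n) = +-mono-≤ {5} {6} (n≤1+n 5) (dim≤ n)

theorem1 : Σ ℕ λ p → Σ ℕ λ q → 1 ≤ p × 1 ≤ q ×
    (∀ (N : ℕ) → Σ ℕ λ d → N < d × Σ (Instance d) λ I →
    ∀ x → Optimal I x → 2 ^ (p * d) ≤ suppSize I x ^ q)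
-- The constant is `c = 1/6`, from `d ≤ 6n` and support at least `2 ^ n`. Taking `n = suc N` makes
-- `n` positive and `d` larger than `N`.
theorem1 = 1 , 6 , s≤s z≤n , s≤s z≤n , λ N →
  let n = suc N
      L = 2 ^ n
      G = gadget L n
      correct = subst (λ l → Correct l G) (sym (length-sols L n)) (gadget-correct n (m^n>0 2 n))
      open Packing G correct
  in dim n , <-trans (n<1+n N) (n<dim n) , inst , λ x optimal → begin
    2 ^ (1 * dim n)       ≡⟨ cong (2 ^_) (*-identityˡ (dim n)) ⟩
    2 ^ dim n             ≤⟨ ^-monoʳ-≤ 2 (dim≤ N) ⟩
    2 ^ (n * 6)           ≡⟨ ^-*-assoc 2 n 6 ⟨
    (2 ^ n) ^ 6           ≡⟨ cong (_^ 6) (length-sols L n) ⟨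
    length (Gadget.sols G) ^ 6  ≤⟨ ^-monoˡ-≤ 6 (large-support optimal) ⟩
    suppSize inst x ^ 6   ∎
  where open ≤-Reasoning
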